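{- We have $r_3(N) = o(N)$ as $N \to \infty$; that is, $\lim_{N\to\infty} r_3(N)/N = 0$, where $r_3(N)$ denotes the largest size of a subset of $\{1,\dots,N\}$ containing no non-trivial three term arithmetic progression.
   Context: For an integer $N \geq 1$, $[N] := \{1,\dots,N\}$, and $r_3(N)$ denotes the size of any largest subset $S \subseteq [N]$ for which there are no solutions to $x + y = 2z$ with $x,y,z \in S$ and $x \neq y$ (i.e. $S$ has no non-trivial three term arithmetic progressions). -}

module Defs where

open import Data.Fin.Base using (Fin; toℕ)
open import Data.Fin.Properties using (all?) renaming (_≟_ to _≟ᶠ_)
open import Data.Fin.Subset using (Subset; inside; outside; _∈_; ∣_∣; ⊥)
open import Data.Fin.Subset.Properties using (_∈?_; ∉⊥)
open import Data.List.Base using (List; []; _∷_; [_]; map; _++_; filter)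
open import Data.List.Extrema.Nat using (argmax; argmax-all; f[xs]≤f[argmax])
open import Data.List.Membership.Propositional renaming (_∈_ to _∈ˡ_)
open import Data.List.Membership.Propositional.Properties
  using (∈-map⁺; ∈-++⁺ˡ; ∈-++⁺ʳ; ∈-filter⁺)
open import Data.List.Relation.Unary.All using (lookup)
open import Data.List.Relation.Unary.All.Properties using (all-filter)
open import Data.List.Relation.Unary.Any using (here)
open import Data.Nat.Base using (ℕ; zero; suc; _+_; _*_; _≤_; NonZero)
open import Data.Nat.Properties using (_≟_)
open import Data.Product.Base using (∃-syntax; _×_; _,_)
open import Data.Rational.Base as ℚ using (ℚ; 0ℚ)
open import Data.Vec.Base using ([]; _∷_)
open import Relation.Binary.PropositionalEquality using (_≡_; _≢_; refl)
open import Relation.Nullary.Decidable using (Dec; ¬?; _→-dec_)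
open import Relation.Nullary.Negation using (contradiction)

-- A subset of [N] = {1,…,N} is a `Subset N`; the index i : Fin N stands for
-- the integer i + 1.
value : ∀ {N} → Fin N → ℕ
value i = suc (toℕ i)

ThreeAPFree : ∀ {N} → Subset N → Set
ThreeAPFree {N} S = ∀ (x y z : Fin N) → x ∈ S → y ∈ S → z ∈ S →
                    x ≢ y → value x + value y ≢ 2 * value z

threeAPFree? : ∀ {N} (S : Subset N) → Dec (ThreeAPFree S)
threeAPFree? S = all? λ x → all? λ y → all? λ z →
  (x ∈? S) →-dec (y ∈? S) →-dec (z ∈? S) →-dec
  ¬? (x ≟ᶠ y) →-dec ¬? (value x + value y ≟ 2 * value z)

allSubsets : ∀ N → List (Subset N)
allSubsets zero    = [ [] ]
allSubsets (suc N) = map (inside ∷_) (allSubsets N) ++ map (outside ∷_) (allSubsets N)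

-- The empty set ⊥ is only the starting value of the maximisation; it is
-- itself one of the admissible sets.
largestThreeAPFree : ∀ N → Subset N
largestThreeAPFree N = argmax ∣_∣ ⊥ (filter threeAPFree? (allSubsets N))

r₃ : ℕ → ℕ
r₃ N = ∣ largestThreeAPFree N ∣

∈-allSubsets : ∀ {N} (S : Subset N) → S ∈ˡ allSubsets N
∈-allSubsets []            = here refl
∈-allSubsets (inside  ∷ S) = ∈-++⁺ˡ (∈-map⁺ (inside ∷_) (∈-allSubsets S))
∈-allSubsets (outside ∷ S) =
  ∈-++⁺ʳ (map (inside ∷_) (allSubsets _)) (∈-map⁺ (outside ∷_) (∈-allSubsets S))

r₃-attained : ∀ N → ∃[ S ] ThreeAPFree {N} S × ∣ S ∣ ≡ r₃ N
r₃-attained N = largestThreeAPFree N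
  , argmax-all ∣_∣ {P = ThreeAPFree} (λ _ _ _ x∈⊥ → contradiction x∈⊥ ∉⊥)
               (all-filter threeAPFree? (allSubsets N))
  , refl

r₃-maximal : ∀ N (S : Subset N) → ThreeAPFree S → ∣ S ∣ ≤ r₃ N
r₃-maximal N S free =
  lookup (f[xs]≤f[argmax] {f = ∣_∣} ⊥ (filter threeAPFree? (allSubsets N)))
         (∈-filter⁺ threeAPFree? (∈-allSubsets S) free)

-- Convergence of a rational sequence indexed by N ≥ 1 to a rational limit.
-- Letting ε range over the positive rationals is no restriction, as every
-- positive real is bounded below by one.
HasLimit : ((N : ℕ) .{{_ : NonZero N}} → ℚ) → ℚ → Set
HasLimit a ℓ = ∀ (ε : ℚ) → 0ℚ ℚ.< ε →
  ∃[ N₀ ] (∀ (N : ℕ) .{{_ : NonZero N}} → N₀ ≤ N → ℚ.∣ a N ℚ.- ℓ ∣ ℚ.< ε)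

{-# OPTIONS --safe #-}
module Submission where

-- Szemerédi's cube proof, run as a density decrement. Let R = r₃(l), and let
-- A ⊆ [0,n) with n = 4w be a largest progression-free set. If its density is
-- neither small nor noticeably below R / l, then A is dense in both [0,w) and [w,2w).
-- So [w,2w) ∩ A contains a Hilbert cube of high dimension with bounded
-- differences. The sets 2Q - (A ∩ [0,w)), with Q an increasing chain of
-- subcubes, avoid A and grow inside [0,n), so for one of them, M, passing to
-- M ∪ (M + 2d) adds few elements. Hence the complement of M is nearly a union
-- of progressions of difference 2d and length l, each with at most R points of
-- A; as M has positive density, A has density well below R / l after all.
-- Only finitely many such decrements by a fixed amount are possible, and a
-- single sparse length bounds all later ones by subadditivity.

open import Defs
open import Data.Bool.Base using (Bool; true; false; T; _∧_; _∨_; not)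
open import Data.Empty using (⊥)
open import Data.Fin.Base as Fin using (toℕ)
open import Data.Fin.Properties using (toℕ-injective)
open import Data.Fin.Subset using (Subset; ∣_∣; _∈_)
open import Data.List.Base using ([]; _∷_)
open import Data.Nat.Base hiding (_/_)
import Data.Nat.DivMod as ℕ
open import Data.Nat.Properties
open import Data.Nat.Tactic.RingSolver using (solve; solve-∀)
open import Data.Product.Base using (∃-syntax; _×_; _,_; proj₁; proj₂)
open import Data.Sum.Base using (_⊎_; inj₁; inj₂)
open import Data.Vec.Base as Vec using (tabulate)
open import Data.Vec.Properties using (lookup∘tabulate; lookup⇒[]=; []=⇒lookup)
open import Function.Base using (_∘_)
open import Relation.Binary.PropositionalEquality
open import Relation.Nullary using (yes; no; contradiction)
open import Relation.Nullary.Decidable using (toWitness)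

-- Linear arithmetic by certificate: b - a is (y - x) plus the slack s, and the
-- ring solver checks the identity.
cancel-≤ : ∀ {a b x y} s → x ≤ y → a + y + s ≡ b + x → a ≤ b
cancel-≤ {a} {b} {x} {y} s x≤y eq = +-cancelʳ-≤ x a b (begin
  a + x      ≤⟨ +-monoʳ-≤ a x≤y ⟩
  a + y      ≤⟨ m≤m+n (a + y) s ⟩
  a + y + s  ≡⟨ eq ⟩
  b + x      ∎)
  where open ≤-Reasoning

-- Finite sums over initial segments of ℕ.

∑ : (ℕ → ℕ) → ℕ → ℕ
∑ f zero    = 0
∑ f (suc n) = ∑ f n + f n

∑-mono-< : ∀ {f g} n → (∀ i → i < n → f i ≤ g i) → ∑ f n ≤ ∑ g n
∑-mono-< zero    f≤g = z≤n
∑-mono-< (suc n) f≤g =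
  +-mono-≤ (∑-mono-< n λ i i<n → f≤g i (m<n⇒m<1+n i<n)) (f≤g n ≤-refl)

∑-mono : ∀ {f g} n → (∀ i → f i ≤ g i) → ∑ f n ≤ ∑ g n
∑-mono n f≤g = ∑-mono-< n λ i _ → f≤g i

∑-cong : ∀ {f g} n → (∀ i → f i ≡ g i) → ∑ f n ≡ ∑ g n
∑-cong zero    f≡g = refl
∑-cong (suc n) f≡g = cong₂ _+_ (∑-cong n f≡g) (f≡g n)

∑-+ : ∀ f g n → ∑ (λ i → f i + g i) n ≡ ∑ f n + ∑ g n
∑-+ f g zero    = refl
∑-+ f g (suc n) rewrite ∑-+ f g n = interchange (∑ f n) (∑ g n) (f n) (g n)
  where
  interchange : ∀ a b c d → a + b + (c + d) ≡ a + c + (b + d)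
  interchange a b c d = solve (a ∷ b ∷ c ∷ d ∷ [])

∑-* : ∀ c f n → ∑ (λ i → c * f i) n ≡ c * ∑ f n
∑-* c f zero    = sym (*-zeroʳ c)
∑-* c f (suc n) rewrite ∑-* c f n = sym (*-distribˡ-+ c (∑ f n) (f n))

∑-const : ∀ c n → ∑ (λ _ → c) n ≡ n * c
∑-const c zero    = refl
∑-const c (suc n) rewrite ∑-const c n = +-comm (n * c) c

∑-swap : ∀ (f : ℕ → ℕ → ℕ) m n →
         ∑ (λ i → ∑ (f i) n) m ≡ ∑ (λ j → ∑ (λ i → f i j) m) n
∑-swap f zero    n = sym (trans (∑-const 0 n) (*-zeroʳ n))
∑-swap f (suc m) n rewrite ∑-swap f m n =
  sym (∑-+ (λ j → ∑ (λ i → f i j) m) (f m) n)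

∑-split : ∀ f m n → ∑ f (m + n) ≡ ∑ f m + ∑ (λ i → f (m + i)) n
∑-split f m zero    = trans (cong (∑ f) (+-identityʳ m)) (sym (+-identityʳ _))
∑-split f m (suc n) = begin
  ∑ f (m + suc n)                                  ≡⟨ cong (∑ f) (+-suc m n) ⟩
  ∑ f (m + n) + f (m + n)                          ≡⟨ cong (_+ f (m + n)) (∑-split f m n) ⟩
  ∑ f m + ∑ (λ i → f (m + i)) n + f (m + n)        ≡⟨ +-assoc (∑ f m) _ _ ⟩
  ∑ f m + (∑ (λ i → f (m + i)) n + f (m + n))      ∎
  where open ≡-Reasoning

∑-suc : ∀ f n → ∑ f (suc n) ≡ f 0 + ∑ (f ∘ suc) n
∑-suc f n = ∑-split f 1 n

∑-blocks : ∀ f n m → ∑ f (m * n) ≡ ∑ (λ j → ∑ (λ i → f (j * n + i)) n) m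
∑-blocks f n zero    = refl
∑-blocks f n (suc m) = begin
  ∑ f (n + m * n)                                ≡⟨ cong (∑ f) (+-comm n (m * n)) ⟩
  ∑ f (m * n + n)                                ≡⟨ ∑-split f (m * n) n ⟩
  ∑ f (m * n) + ∑ (λ i → f (m * n + i)) n        ≡⟨ cong (_+ ∑ (λ i → f (m * n + i)) n) (∑-blocks f n m) ⟩
  ∑ (λ j → ∑ (λ i → f (j * n + i)) n) m + ∑ (λ i → f (m * n + i)) n  ∎
  where open ≡-Reasoning

∑-monoʳ : ∀ f {m n} → m ≤ n → ∑ f m ≤ ∑ f n
∑-monoʳ f {m} {n} m≤n = begin
  ∑ f m              ≤⟨ m≤m+n _ _ ⟩
  ∑ f m + _          ≡⟨ ∑-split f m (n ∸ m) ⟨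
  ∑ f (m + (n ∸ m))  ≡⟨ cong (∑ f) (m+[n∸m]≡n m≤n) ⟩
  ∑ f n              ∎
  where open ≤-Reasoning

∑-vanish : ∀ f m n → (∀ i → m ≤ i → f i ≡ 0) → ∑ f (m + n) ≡ ∑ f m
∑-vanish f m n f≡0 = begin
  ∑ f (m + n)                        ≡⟨ ∑-split f m n ⟩
  ∑ f m + ∑ (λ i → f (m + i)) n      ≡⟨ cong (∑ f m +_) (∑-cong n λ i → f≡0 (m + i) (m≤m+n m i)) ⟩
  ∑ f m + ∑ (λ _ → 0) n              ≡⟨ cong (∑ f m +_) (trans (∑-const 0 n) (*-zeroʳ n)) ⟩
  ∑ f m + 0                          ≡⟨ +-identityʳ _ ⟩
  ∑ f m                              ∎
  where open ≡-Reasoning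

∑-reverse : ∀ f n → ∑ (λ i → f (n ∸ i)) (suc n) ≡ ∑ f (suc n)
∑-reverse f zero    = refl
∑-reverse f (suc n) = begin
  ∑ (λ i → f (suc n ∸ i)) (suc (suc n))       ≡⟨ ∑-suc (λ i → f (suc n ∸ i)) (suc n) ⟩
  f (suc n) + ∑ (λ i → f (n ∸ i)) (suc n)     ≡⟨ cong (f (suc n) +_) (∑-reverse f n) ⟩
  f (suc n) + ∑ f (suc n)                     ≡⟨ +-comm (f (suc n)) _ ⟩
  ∑ f (suc n) + f (suc n)                     ∎
  where open ≡-Reasoning

pigeonhole : ∀ f n → 1 ≤ n → ∃[ i ] i < n × ∑ f n ≤ n * f i
pigeonhole f (suc zero)    _ = 0 , ≤-refl , ≤-reflexive (sym (+-identityʳ (f 0)))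
pigeonhole f (suc (suc n)) _ with pigeonhole f (suc n) (s≤s z≤n)
... | i , i<n , le with ≤-total (f i) (f (suc n))
...   | inj₁ fi≤ = suc n , ≤-refl , (begin
  ∑ f (suc n) + f (suc n)            ≤⟨ +-monoˡ-≤ _ le ⟩
  suc n * f i + f (suc n)            ≤⟨ +-monoˡ-≤ _ (*-monoʳ-≤ (suc n) fi≤) ⟩
  suc n * f (suc n) + f (suc n)      ≡⟨ +-comm (suc n * f (suc n)) _ ⟩
  suc (suc n) * f (suc n)            ∎)
  where open ≤-Reasoning
...   | inj₂ ≤fi = i , m<n⇒m<1+n i<n , (begin
  ∑ f (suc n) + f (suc n)            ≤⟨ +-mono-≤ le ≤fi ⟩
  suc n * f i + f i                  ≡⟨ +-comm (suc n * f i) _ ⟩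
  suc (suc n) * f i                  ∎)
  where open ≤-Reasoning

-- Indicators and counting.

⟦_⟧ : Bool → ℕ
⟦ false ⟧ = 0
⟦ true  ⟧ = 1

⟦⟧≤1 : ∀ b → ⟦ b ⟧ ≤ 1
⟦⟧≤1 false = z≤n
⟦⟧≤1 true  = ≤-refl

⟦⟧-mono : ∀ {a b} → (a ≡ true → b ≡ true) → ⟦ a ⟧ ≤ ⟦ b ⟧
⟦⟧-mono {false} _   = z≤n
⟦⟧-mono {true}  a⇒b rewrite a⇒b refl = ≤-refl

# : (ℕ → Bool) → ℕ → ℕ
# A = ∑ (λ x → ⟦ A x ⟧)

#≤ : ∀ A n → # A n ≤ n
#≤ A n = begin
  # A n           ≤⟨ ∑-mono n (λ i → ⟦⟧≤1 (A i)) ⟩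
  ∑ (λ _ → 1) n   ≡⟨ ∑-const 1 n ⟩
  n * 1           ≡⟨ *-identityʳ n ⟩
  n               ∎
  where open ≤-Reasoning

∧-true : ∀ {a b} → a ∧ b ≡ true → a ≡ true × b ≡ true
∧-true {true} {true} _ = refl , refl

true-∧ : ∀ {a b} → a ≡ true → b ≡ true → a ∧ b ≡ true
true-∧ refl refl = refl

∨-true : ∀ {a b} → a ∨ b ≡ true → a ≡ true ⊎ b ≡ true
∨-true {true}  _  = inj₁ refl
∨-true {false} eq = inj₂ eq

<ᵇ-true : ∀ {m n} → (m <ᵇ n) ≡ true → m < n
<ᵇ-true {m} {n} eq = <ᵇ⇒< m n (subst T (sym eq) _)

true-<ᵇ : ∀ {m n} → m < n → (m <ᵇ n) ≡ true
true-<ᵇ {m} {n} lt with m <ᵇ n | <⇒<ᵇ lt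
... | true | _ = refl

-- Progression-free predicates and their relation to `r₃`.

-- Sets are Boolean predicates on all of ℕ, so that translates and dilates are compositions; an
-- interval enters only as the length at which `#` counts.
APFree : (ℕ → Bool) → Set
APFree A = ∀ x y z → A x ≡ true → A y ≡ true → A z ≡ true → x + y ≡ 2 * z → x ≡ y

APFree-translate : ∀ {A} c → APFree A → APFree (λ i → A (c + i))
APFree-translate c free x y z Ax Ay Az eq =
  +-cancelˡ-≡ c x y (free (c + x) (c + y) (c + z) Ax Ay Az (begin
    c + x + (c + y)      ≡⟨ solve (c ∷ x ∷ y ∷ []) ⟩
    2 * c + (x + y)      ≡⟨ cong (2 * c +_) eq ⟩
    2 * c + 2 * z        ≡⟨ solve (c ∷ z ∷ []) ⟩
    2 * (c + z)          ∎))
  where open ≡-Reasoning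

APFree-dilate : ∀ {A} d → APFree A → APFree (λ i → A (i * suc d))
APFree-dilate d free x y z Ax Ay Az eq =
  *-cancelʳ-≡ x y (suc d) (free (x * suc d) (y * suc d) (z * suc d) Ax Ay Az (begin
    x * suc d + y * suc d  ≡⟨ *-distribʳ-+ (suc d) x y ⟨
    (x + y) * suc d        ≡⟨ cong (_* suc d) eq ⟩
    2 * z * suc d          ≡⟨ *-assoc 2 z (suc d) ⟩
    2 * (z * suc d)        ∎))
  where open ≡-Reasoning

value-equation : ∀ {a b c} → a + b ≡ 2 * c → suc a + suc b ≡ 2 * suc c
value-equation {a} {b} {c} eq = begin
  suc a + suc b    ≡⟨ cong suc (+-suc a b) ⟩
  2 + (a + b)      ≡⟨ cong (2 +_) eq ⟩
  2 + 2 * c        ≡⟨ *-suc 2 c ⟨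
  2 * suc c        ∎
  where open ≡-Reasoning

value-equation⁻¹ : ∀ {a b c} → suc a + suc b ≡ 2 * suc c → a + b ≡ 2 * c
value-equation⁻¹ {a} {b} {c} eq = +-cancelˡ-≡ 2 _ _ (begin
  2 + (a + b)      ≡⟨ cong suc (+-suc a b) ⟨
  suc a + suc b    ≡⟨ eq ⟩
  2 * suc c        ≡⟨ *-suc 2 c ⟩
  2 + 2 * c        ∎)
  where open ≡-Reasoning

∣tabulate∣ : ∀ A n → ∣ tabulate {n = n} (A ∘ toℕ) ∣ ≡ # A n
∣tabulate∣ A zero    = refl
∣tabulate∣ A (suc n) with A 0 | ∑-suc (λ x → ⟦ A x ⟧) n
... | true  | eq = trans (cong suc (∣tabulate∣ (A ∘ suc) n)) (sym eq)
... | false | eq = trans (∣tabulate∣ (A ∘ suc) n) (sym eq)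

#≤r₃ : ∀ {A} → APFree A → ∀ n → # A n ≤ r₃ n
#≤r₃ {A} free n = subst (_≤ r₃ n) (∣tabulate∣ A n) (r₃-maximal n S S-free)
  where
  S : Subset n
  S = tabulate (A ∘ toℕ)

  in-A : ∀ {i} → i ∈ S → A (toℕ i) ≡ true
  in-A {i} i∈S = trans (sym (lookup∘tabulate (A ∘ toℕ) i)) ([]=⇒lookup i∈S)

  S-free : ThreeAPFree S
  S-free x y z x∈ y∈ z∈ x≢y eq = x≢y (toℕ-injective
    (free (toℕ x) (toℕ y) (toℕ z) (in-A x∈) (in-A y∈) (in-A z∈) (value-equation⁻¹ eq)))

-- The value `false` from n on makes a progression-free subset of [n] progression-free on all of ℕ.
indicator : ∀ {n} → Subset n → ℕ → Bool
indicator Vec.[]      _       = false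
indicator (s Vec.∷ S) zero    = s
indicator (s Vec.∷ S) (suc x) = indicator S x

indicator-∈ : ∀ {n} (S : Subset n) x → indicator S x ≡ true → ∃[ i ] toℕ i ≡ x × i ∈ S
indicator-∈ (s Vec.∷ S) zero    eq = Fin.zero , refl , lookup⇒[]= Fin.zero _ eq
indicator-∈ (s Vec.∷ S) (suc x) eq with indicator-∈ S x eq
... | i , refl , i∈S = Fin.suc i , refl , Vec.there i∈S

#-indicator : ∀ {n} (S : Subset n) → # (indicator S) n ≡ ∣ S ∣
#-indicator Vec.[] = refl
#-indicator {suc n} (true  Vec.∷ S) =
  trans (∑-suc (λ x → ⟦ indicator (true Vec.∷ S) x ⟧) n) (cong suc (#-indicator S))
#-indicator {suc n} (false Vec.∷ S) =
  trans (∑-suc (λ x → ⟦ indicator (false Vec.∷ S) x ⟧) n) (#-indicator S)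

indicator-APFree : ∀ {n} {S : Subset n} → ThreeAPFree S → APFree (indicator S)
indicator-APFree {S = S} free x y z Ax Ay Az eq
  with indicator-∈ S x Ax | indicator-∈ S y Ay | indicator-∈ S z Az
... | i , refl , i∈ | j , refl , j∈ | k , refl , k∈ with toℕ i ≟ toℕ j
...   | yes i≡j = i≡j
...   | no  i≢j = contradiction (value-equation eq)
                    (free i j k i∈ j∈ k∈ (i≢j ∘ cong toℕ))

extremal : ∀ n → ∃[ A ] APFree A × # A n ≡ r₃ n
extremal n with r₃-attained n
... | S , free , card = indicator S , indicator-APFree free , trans (#-indicator S) card

r₃≤ : ∀ n → r₃ n ≤ n
r₃≤ n with extremal n
... | A , _ , eq = subst (_≤ n) eq (#≤ A n)

-- Cut [0,m) into blocks of length l, each with at most `r₃ l` points, and a remainder shorter than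
-- l, bounded by its length.
r₃-scaling : ∀ l .{{_ : NonZero l}} m → l * r₃ m ≤ r₃ l * m + l * l
r₃-scaling l m with extremal m
... | A , free , eq = begin
  l * r₃ m                        ≡⟨ cong (l *_) eq ⟨
  l * # A m                       ≡⟨ cong (λ m → l * # A m) m≡ ⟩
  l * # A (c * l + t)             ≡⟨ cong (l *_) (∑-split (λ x → ⟦ A x ⟧) (c * l) t) ⟩
  l * (# A (c * l) + # (λ i → A (c * l + i)) t)
                                  ≤⟨ *-monoʳ-≤ l (+-mono-≤ blocks (#≤ _ t)) ⟩
  l * (c * R + t)                 ≡⟨ *-distribˡ-+ l (c * R) t ⟩
  l * (c * R) + l * t             ≡⟨ cong (_+ l * t) rearrange ⟩
  R * (c * l) + l * t             ≤⟨ +-mono-≤ (*-monoʳ-≤ R c*l≤m) (*-monoʳ-≤ l (<⇒≤ (ℕ.m%n<n m l))) ⟩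
  R * m + l * l                   ∎
  where
  open ≤-Reasoning
  R = r₃ l
  c = m ℕ./ l
  t = m ℕ.% l
  m≡ : m ≡ c * l + t
  m≡ = trans (ℕ.m≡m%n+[m/n]*n m l) (+-comm t (c * l))
  c*l≤m : c * l ≤ m
  c*l≤m = subst (c * l ≤_) (sym m≡) (m≤m+n (c * l) t)
  rearrange : l * (c * R) ≡ R * (c * l)
  rearrange = trans (*-comm l (c * R)) (trans (cong (_* l) (*-comm c R)) (*-assoc R c l))
  blocks : # A (c * l) ≤ c * R
  blocks = begin
    # A (c * l)                             ≡⟨ ∑-blocks (λ x → ⟦ A x ⟧) l c ⟩
    ∑ (λ j → # (λ i → A (j * l + i)) l) c   ≤⟨ ∑-mono c (λ j → #≤r₃ (APFree-translate (j * l) free) l) ⟩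
    ∑ (λ _ → R) c                           ≡⟨ ∑-const R c ⟩
    c * R                                   ∎

-- Pair counting and Hilbert cubes.

⟦⟧-idem : ∀ b → ⟦ b ⟧ * ⟦ b ⟧ ≡ ⟦ b ⟧
⟦⟧-idem false = refl
⟦⟧-idem true  = refl

⟦∧⟧ : ∀ a b → ⟦ a ∧ b ⟧ ≡ ⟦ a ⟧ * ⟦ b ⟧
⟦∧⟧ false b = refl
⟦∧⟧ true  b = sym (+-identityʳ ⟦ b ⟧)

#-inhabited : ∀ A n → 1 ≤ # A n → ∃[ x ] A x ≡ true
#-inhabited A (suc n) 1≤ with A n in eq
... | true  = n , eq
... | false = #-inhabited A n (subst (1 ≤_) (+-identityʳ (# A n)) 1≤)

-- The sum counts the pairs y ≤ x of elements of A below n.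
triangular : ∀ A n → 2 * ∑ (λ x → ⟦ A x ⟧ * # A (suc x)) n ≡ # A n * # A n + # A n
triangular A zero    = refl
triangular A (suc n) = begin
  2 * (t + f * (b + f))                ≡⟨ expand t f b ⟩
  2 * t + 2 * f * b + f * f + f * f    ≡⟨ cong₂ (λ u v → u + 2 * f * b + f * f + v)
                                            (triangular A n) (⟦⟧-idem (A n)) ⟩
  b * b + b + 2 * f * b + f * f + f    ≡⟨ collect f b ⟩
  (b + f) * (b + f) + (b + f)          ∎
  where
  open ≡-Reasoning
  f = ⟦ A n ⟧
  b = # A n
  t = ∑ (λ x → ⟦ A x ⟧ * # A (suc x)) n
  expand : ∀ t f b → 2 * (t + f * (b + f)) ≡ 2 * t + 2 * f * b + f * f + f * f
  expand = solve-∀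
  collect : ∀ f b → b * b + b + 2 * f * b + f * f + f ≡ (b + f) * (b + f) + (b + f)
  collect = solve-∀

-- A ∩ B - d is A ∩ (B - d).
_∩_-_ : (ℕ → Bool) → (ℕ → Bool) → ℕ → ℕ → Bool
(A ∩ B - d) x = A x ∧ B (d + x)

-- For x in A, each element of A below n is either at most x or equal to x + `suc d` with d < n.
-- Over all x, `triangular` counts the first kind; the sum over d covers the second. Points x +
-- `suc d` beyond n only enlarge that sum.
pair-count : ∀ A n → # A n * # A n ≤ 2 * ∑ (λ d → # (A ∩ A - suc d) n) n + # A n
pair-count A n = cancel-≤ 0 (*-monoʳ-≤ 2 main) (begin
  b * b + 2 * (t + h) + 0     ≡⟨ lhs b t h ⟩
  2 * t + (b * b + 2 * h)     ≡⟨ cong (_+ (b * b + 2 * h)) (triangular A n) ⟩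
  b * b + b + (b * b + 2 * h) ≡⟨ rhs b h ⟩
  2 * h + b + 2 * (b * b)     ∎)
  where
  f = λ x → ⟦ A x ⟧
  b = # A n
  t = ∑ (λ x → f x * # A (suc x)) n
  h = ∑ (λ d → # (A ∩ A - suc d) n) n

  lhs : ∀ b t h → b * b + 2 * (t + h) + 0 ≡ 2 * t + (b * b + 2 * h)
  lhs = solve-∀
  rhs : ∀ b h → b * b + b + (b * b + 2 * h) ≡ 2 * h + b + 2 * (b * b)
  rhs = solve-∀

  tail : ∀ x → b ≤ # A (suc x) + ∑ (λ d → f (suc x + d)) n
  tail x = subst (b ≤_) (∑-split f (suc x) n) (∑-monoʳ f (m≤n+m n (suc x)))

  h≡ : ∑ (λ x → f x * ∑ (λ d → f (suc x + d)) n) n ≡ h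
  h≡ = begin
    ∑ (λ x → f x * ∑ (λ d → f (suc x + d)) n) n
      ≡⟨ ∑-cong n (λ x → sym (∑-* (f x) (λ d → f (suc x + d)) n)) ⟩
    ∑ (λ x → ∑ (λ d → f x * f (suc x + d)) n) n
      ≡⟨ ∑-swap (λ x d → f x * f (suc x + d)) n n ⟩
    ∑ (λ d → ∑ (λ x → f x * f (suc x + d)) n) n
      ≡⟨ ∑-cong n (λ d → ∑-cong n (λ x →
           trans (cong (λ y → f x * f (suc y)) (+-comm x d)) (sym (⟦∧⟧ (A x) (A (suc d + x)))))) ⟩
    h ∎
    where open ≡-Reasoning

  main : b * b ≤ t + h
  main = begin
    b * b                                                   ≡⟨ ∑-* b f n ⟨
    ∑ (λ x → b * f x) n                                     ≤⟨ ∑-mono n (λ x → begin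
      b * f x                                                 ≡⟨ *-comm b (f x) ⟩
      f x * b                                                 ≤⟨ *-monoʳ-≤ (f x) (tail x) ⟩
      f x * (# A (suc x) + ∑ (λ d → f (suc x + d)) n)         ≡⟨ *-distribˡ-+ (f x) _ _ ⟩
      f x * # A (suc x) + f x * ∑ (λ d → f (suc x + d)) n     ∎) ⟩
    ∑ (λ x → f x * # A (suc x) + f x * ∑ (λ d → f (suc x + d)) n) n
                                                            ≡⟨ ∑-+ (λ x → f x * # A (suc x)) _ n ⟩
    t + ∑ (λ x → f x * ∑ (λ d → f (suc x + d)) n) n         ≡⟨ cong (t +_) h≡ ⟩
    t + h                                                   ∎
    where open ≤-Reasoning
  open ≡-Reasoning

-- A Hilbert cube inside A: a base point plus all subset sums of k differences between 1 and s.
-- Intersecting A with its translates lets inductions peel off one difference at a time.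
Cube : ℕ → (ℕ → Bool) → ℕ → Set
Cube s A zero    = ∃[ y ] A y ≡ true
Cube s A (suc k) = ∃[ d ] suc d ≤ s × Cube s (A ∩ A - suc d) k

-- A set of density at least 1/q in [0,s) has on average many pairs per difference, so some
-- difference d + 1 leaves density at least 1/(4q²).
popular-difference : ∀ q s A → 2 * q < s → s ≤ q * # A s →
  ∃[ d ] d < s × s ≤ 4 * (q * q) * # (A ∩ A - suc d) s
popular-difference q s A 2q<s dense
  with pigeonhole (λ d → # (A ∩ A - suc d) s) s (≤-trans (s≤s z≤n) 2q<s)
... | d , d<s , popular = d , d<s , *-cancelˡ-≤ s (begin
    s * s                             ≤⟨ *-mono-≤ dense dense ⟩
    q * b * (q * b)                   ≡⟨ [m*n]*[o*p]≡[m*o]*[n*p] q b q b ⟩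
    q * q * (b * b)                   ≤⟨ *-monoʳ-≤ (q * q) b*b≤4h ⟩
    q * q * (4 * (s * g))             ≡⟨ regroup q s g ⟩
    s * (4 * (q * q) * g)             ∎)
  where
  open ≤-Reasoning
  instance
    s≢0 : NonZero s
    s≢0 = >-nonZero (≤-trans (s≤s z≤n) 2q<s)
  b = # A s
  g = # (A ∩ A - suc d) s

  regroup : ∀ q s g → q * q * (4 * (s * g)) ≡ s * (4 * (q * q) * g)
  regroup = solve-∀
  absorb : ∀ b s g → b * b + (2 * (2 * (s * g) + b) + b * b) + 0 ≡ 4 * (s * g) + (2 * (b * b) + 2 * b)
  absorb = solve-∀

  -- Having two points gives 2b ≤ b², which absorbs the linear term of `pair-count` into a factor 2.
  2≤b : 2 ≤ b
  2≤b with 2 ≤? b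
  ... | yes 2≤b = 2≤b
  ... | no  2≰b = contradiction 2q<s (≤⇒≯ (begin
    s       ≤⟨ dense ⟩
    q * b   ≤⟨ *-monoʳ-≤ q (<⇒≤ (≰⇒> 2≰b)) ⟩
    q * 2   ≡⟨ *-comm q 2 ⟩
    2 * q   ∎))

  b*b≤2h+b : b * b ≤ 2 * (s * g) + b
  b*b≤2h+b = ≤-trans (pair-count A s) (+-monoˡ-≤ b (*-monoʳ-≤ 2 popular))

  b*b≤4h : b * b ≤ 4 * (s * g)
  b*b≤4h = cancel-≤ 0 (+-mono-≤ (*-monoʳ-≤ 2 b*b≤2h+b) (*-monoˡ-≤ b 2≤b)) (begin-equality
    b * b + (2 * (2 * (s * g) + b) + b * b) + 0  ≡⟨ absorb b s g ⟩
    4 * (s * g) + (2 * (b * b) + 2 * b)          ∎)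

-- The sum dominates both demands of a step of `cube-lemma`: 2q < s now, and the threshold for
-- inverse density 4q² afterwards.
cube-threshold : ℕ → ℕ → ℕ
cube-threshold zero    q = 1
cube-threshold (suc k) q = suc (2 * q) + cube-threshold k (4 * (q * q))

cube-lemma : ∀ k q {s} → cube-threshold k q ≤ s → ∀ A → s ≤ q * # A s → Cube s A k
cube-lemma zero    q {s} 1≤s A dense with # A s in eq
... | zero  = contradiction (≤-trans 1≤s (subst (s ≤_) (*-zeroʳ q) dense)) λ ()
... | suc c = #-inhabited A s (subst (1 ≤_) (sym eq) (s≤s z≤n))
cube-lemma (suc k) q {s} t≤s A dense
  with popular-difference q s A (m+n≤o⇒m≤o _ t≤s) dense
... | d , d<s , dense′ =
  d , d<s , cube-lemma k (4 * (q * q)) (m+n≤o⇒n≤o (suc (2 * q)) t≤s) (A ∩ A - suc d) dense′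

1≤cube-threshold : ∀ k q → 1 ≤ cube-threshold k q
1≤cube-threshold zero    q = ≤-refl
1≤cube-threshold (suc k) q = s≤s z≤n

-- Reflections of X in the points of a cube.

module Reflections (X : ℕ → Bool) (n : ℕ) where

  infix 4 _⊑_
  -- This is M ⊆ 2B - X: each z in M ends a progression x, m, z with x in X and m in B.
  _⊑_ : (ℕ → Bool) → (ℕ → Bool) → Set
  M ⊑ B = ∀ z → M z ≡ true → ∃[ m ] ∃[ x ] B m ≡ true × X x ≡ true × x + z ≡ 2 * m

  -- The guard is needed because 2 * y ∸ z is 0 when z > 2 * y.
  reflection : ℕ → ℕ → Bool
  reflection y z = (z <ᵇ suc (2 * y)) ∧ X (2 * y ∸ z)

  reflection-⊑ : ∀ {B y} → B y ≡ true → reflection y ⊑ B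
  reflection-⊑ {y = y} By z eq with ∧-true {z <ᵇ suc (2 * y)} eq
  ... | z< , Xx = y , 2 * y ∸ z , By , Xx , m∸n+n≡m (≤-pred (<ᵇ-true {z} z<))

  #-reflection : ∀ {w y} → w ≤ y → 2 * y < n → # X w ≤ # (reflection y) n
  #-reflection {w} {y} w≤y 2y<n = begin
    # X w                                       ≤⟨ ∑-monoʳ _ (≤-trans w≤y (≤-trans (m≤m+n y _) (n≤1+n _))) ⟩
    # X (suc (2 * y))                           ≡⟨ ∑-reverse _ (2 * y) ⟨
    ∑ (λ z → ⟦ X (2 * y ∸ z) ⟧) (suc (2 * y))   ≤⟨ ∑-mono-< (suc (2 * y)) (λ z z< →
                                                     ⟦⟧-mono λ eq → true-∧ (true-<ᵇ z<) eq) ⟩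
    # (reflection y) (suc (2 * y))              ≤⟨ ∑-monoʳ _ 2y<n ⟩
    # (reflection y) n                          ∎
    where open ≤-Reasoning

  -- M ∪ M′ + e is M ∪ (M′ + e).
  _∪_+_ : (ℕ → Bool) → (ℕ → Bool) → ℕ → ℕ → Bool
  (M ∪ M′ + e) z = M z ∨ ((e <ᵇ suc z) ∧ M′ (z ∸ e))

  -- Both m and m + d lie in B, and moving the midpoint by d with x fixed moves z by 2d.
  ∪+-⊑ : ∀ {M B d} → M ⊑ (B ∩ B - d) → M ∪ M + (2 * d) ⊑ B
  ∪+-⊑ {M} {B} {d} M⊑ z eq with ∨-true {M z} eq
  ... | inj₁ Mz with M⊑ z Mz
  ...   | m , x , Bm , Xx , e = m , x , proj₁ (∧-true Bm) , Xx , e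
  ∪+-⊑ {M} {B} {d} M⊑ z eq | inj₂ eq′ with ∧-true {2 * d <ᵇ suc z} eq′
  ... | 2d≤z , Mz with M⊑ (z ∸ 2 * d) Mz
  ...   | m , x , Bm , Xx , e = d + m , x , proj₂ (∧-true {B m} Bm) , Xx , (begin
    x + z                          ≡⟨ cong (x +_) (m+[n∸m]≡n (≤-pred (<ᵇ-true {2 * d} 2d≤z))) ⟨
    x + (2 * d + (z ∸ 2 * d))      ≡⟨ +-comm x _ ⟩
    2 * d + (z ∸ 2 * d) + x        ≡⟨ +-assoc (2 * d) _ x ⟩
    2 * d + ((z ∸ 2 * d) + x)      ≡⟨ cong (2 * d +_) (trans (+-comm _ x) e) ⟩
    2 * d + 2 * m                  ≡⟨ *-distribˡ-+ 2 d m ⟨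
    2 * (d + m)                    ∎)
    where open ≡-Reasoning

  ∪+-⊇ : ∀ M e z → M z ≡ true → (M ∪ M + e) z ≡ true
  ∪+-⊇ M e z Mz rewrite Mz = refl

  ∪+-shift : ∀ M e z → M z ≡ true → (M ∪ M + e) (e + z) ≡ true
  ∪+-shift M e z Mz with M (e + z)
  ... | true  = refl
  ... | false = true-∧ (true-<ᵇ (s≤s (m≤m+n e z))) (trans (cong M (m+n∸m≡n e z)) Mz)

  SlowStep : (B : ℕ → Bool) (c s g : ℕ) → Set
  SlowStep B c s g = ∃[ d ] ∃[ M ] suc d ≤ s × M ⊑ B × (M ∪ M + (2 * suc d)) ⊑ B ×
    c ≤ # M n × # (M ∪ M + (2 * suc d)) n ≤ # M n + g

  -- Peeling off the outermost difference d of the cube turns M into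
  -- M ∪ (M + 2d), because the midpoints move by d. These sets stay inside
  -- [0,n), so k steps that each gain more than g elements need n > k * g.
  slow-step-or-large : ∀ {c s} g B k → Cube s B k →
    (∀ y → B y ≡ true → c ≤ # (reflection y) n) →
    SlowStep B c s g ⊎ ∃[ M ] M ⊑ B × c ≤ # M n × k * suc g ≤ # M n
  slow-step-or-large g B zero (y , By) base =
    inj₂ (reflection y , reflection-⊑ By , base y By , z≤n)
  slow-step-or-large {c} g B (suc k) (d , d≤s , cube) base
    -- The recursion runs in B ∩ (B - `suc d`), so that adjoining the translate of M by 2 * `suc d`
    -- stays within 2B - X.
    with slow-step-or-large g (B ∩ B - suc d) k cube (λ y By → base y (proj₁ (∧-true By)))
  ... | inj₁ (d′ , M , d′≤s , M⊑ , M′⊑ , c≤ , slow) =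
    inj₁ (d′ , M , d′≤s , weaken M⊑ , weaken M′⊑ , c≤ , slow)
    where
    weaken : ∀ {M} → M ⊑ (B ∩ B - suc d) → M ⊑ B
    weaken M⊑ z Mz with M⊑ z Mz
    ... | m , x , Bm , rest = m , x , proj₁ (∧-true Bm) , rest
  ... | inj₂ (M , M⊑ , c≤ , large) with # (M ∪ M + (2 * suc d)) n ≤? # M n + g
  ...   | yes slow = inj₁ (d , M , d≤s ,
            (λ z Mz → let m , x , Bm , rest = M⊑ z Mz in m , x , proj₁ (∧-true Bm) , rest) ,
            ∪+-⊑ M⊑ , c≤ , slow)
  ...   | no ¬slow = inj₂ (M ∪ M + (2 * suc d) , ∪+-⊑ M⊑ ,
            ≤-trans c≤ (∑-mono n λ z → ⟦⟧-mono (∪+-⊇ M (2 * suc d) z)) , (begin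
              suc g + k * suc g        ≤⟨ +-monoʳ-≤ (suc g) large ⟩
              suc g + # M n            ≡⟨ cong suc (+-comm g _) ⟩
              suc (# M n + g)          ≤⟨ ≰⇒> ¬slow ⟩
              # (M ∪ M + (2 * suc d)) n ∎))
    where open ≤-Reasoning

-- Counting A along sliding progressions of difference D.

#-shift-≤ : ∀ A n e → (∀ z → A z ≡ true → z < n) → # (λ j → A (j + e)) n ≤ # A n
#-shift-≤ A n e bounded = begin
  # (λ j → A (j + e)) n          ≡⟨ ∑-cong n (λ j → cong (⟦_⟧ ∘ A) (+-comm j e)) ⟩
  # (λ j → A (e + j)) n          ≤⟨ m≤n+m _ (# A e) ⟩
  # A e + # (λ j → A (e + j)) n  ≡⟨ ∑-split (⟦_⟧ ∘ A) e n ⟨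
  # A (e + n)                    ≡⟨ cong (# A) (+-comm e n) ⟩
  # A (n + e)                    ≡⟨ ∑-vanish (⟦_⟧ ∘ A) n e outside ⟩
  # A n                          ∎
  where
  open ≤-Reasoning
  outside : ∀ z → n ≤ z → ⟦ A z ⟧ ≡ 0
  outside z n≤z with A z in eq
  ... | false = refl
  ... | true  = contradiction (bounded z eq) (≤⇒≯ n≤z)

#-shift-≥ : ∀ A n e → # A n ≤ # (λ j → A (j + e)) n + e
#-shift-≥ A n e = begin
  # A n                          ≤⟨ ∑-monoʳ (⟦_⟧ ∘ A) (m≤n+m n e) ⟩
  # A (e + n)                    ≡⟨ ∑-split (⟦_⟧ ∘ A) e n ⟩
  # A e + # (λ j → A (e + j)) n  ≡⟨ +-comm (# A e) _ ⟩
  # (λ j → A (e + j)) n + # A e  ≤⟨ +-mono-≤ (≤-reflexive (∑-cong n (λ j → cong (⟦_⟧ ∘ A) (+-comm e j)))) (#≤ A e) ⟩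
  # (λ j → A (j + e)) n + e      ∎
  where open ≤-Reasoning

module SlidingProgressions
  (A M M′ : ℕ → Bool) (n D l R g : ℕ)
  (windows  : ∀ j → # (λ i → A (j + i * D)) l ≤ R)
  (disjoint : ∀ z → M z ≡ true → A z ≡ false)
  (M⊆M′     : ∀ z → M z ≡ true → M′ z ≡ true)
  (shift    : ∀ z → M z ≡ true → M′ (D + z) ≡ true)
  (bounded  : ∀ z → M′ z ≡ true → z < n)
  (slow     : # M′ n ≤ # M n + g)
  where

  -- The points gained on passing from M to M′. By `shift`, a progression of difference D can leave
  -- M only through U.
  U : ℕ → Bool
  U z = M′ z ∧ not (M z)

  #U≤g : # U n ≤ g
  #U≤g = +-cancelˡ-≤ (# M n) _ _ (begin
    # M n + # U n                      ≡⟨ ∑-+ (⟦_⟧ ∘ M) (⟦_⟧ ∘ U) n ⟨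
    ∑ (λ z → ⟦ M z ⟧ + ⟦ U z ⟧) n      ≡⟨ ∑-cong n decompose ⟩
    # M′ n                             ≤⟨ slow ⟩
    # M n + g                          ∎)
    where
    open ≤-Reasoning
    decompose : ∀ z → ⟦ M z ⟧ + ⟦ U z ⟧ ≡ ⟦ M′ z ⟧
    decompose z with M z in eq
    ... | true rewrite M⊆M′ z eq = refl
    ... | false with M′ z
    ...   | true  = refl
    ...   | false = refl

  next : ∀ j e D → j + (D + e) ≡ D + (j + e)
  next = solve-∀

  -- From a point of M, the progression stays in M up to step i or it has met U.
  exit : ∀ j → M j ≡ true → ∀ i →
         1 ≤ ⟦ M (j + i * D) ⟧ + # (λ i → U (j + i * D)) (suc i)
  exit j Mj zero    rewrite +-identityʳ j | Mj = s≤s z≤n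
  exit j Mj (suc i) with M (j + i * D) in eq | exit j Mj i
  ... | false | 1≤ = m≤n⇒m≤o+n ⟦ M (j + suc i * D) ⟧ (m≤n⇒m≤n+o ⟦ U (j + suc i * D) ⟧ 1≤)
  ... | true  | _  with M (j + suc i * D) in eq′
  ...   | true  = s≤s z≤n
  ...   | false rewrite trans (cong M′ (next j (i * D) D)) (shift (j + i * D) eq) =
            m≤n+m 1 _

  -- A point of A is outside M, so a progression that started in M has met U on the way to it.
  hit : ∀ j → M j ≡ true → ∀ i → i < l → ⟦ A (j + i * D) ⟧ ≤ # (λ i → U (j + i * D)) l
  hit j Mj i i<l = ≤-trans
    (+-cancelˡ-≤ ⟦ M (j + i * D) ⟧ _ _ (≤-trans (exclusive (j + i * D)) (exit j Mj i)))
    (∑-monoʳ (λ i → ⟦ U (j + i * D) ⟧) i<l)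
    where
    exclusive : ∀ z → ⟦ M z ⟧ + ⟦ A z ⟧ ≤ 1
    exclusive z with M z in eq
    ... | true  rewrite disjoint z eq = ≤-refl
    ... | false = ⟦⟧≤1 (A z)

  -- A window starting in M saves R: its points of A, at most l of them, are each charged to its
  -- meetings with U. Any other window has at most R points of A.
  window-bound : ∀ j → # (λ i → A (j + i * D)) l + R * ⟦ M j ⟧
                       ≤ R + l * # (λ i → U (j + i * D)) l
  window-bound j with M j in eq
  ... | false = begin
    # (λ i → A (j + i * D)) l + R * 0           ≡⟨ cong (# (λ i → A (j + i * D)) l +_) (*-zeroʳ R) ⟩
    # (λ i → A (j + i * D)) l + 0               ≡⟨ +-identityʳ _ ⟩
    # (λ i → A (j + i * D)) l                   ≤⟨ windows j ⟩
    R                                           ≤⟨ m≤m+n R _ ⟩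
    R + l * # (λ i → U (j + i * D)) l           ∎
    where open ≤-Reasoning
  ... | true  = begin
    # (λ i → A (j + i * D)) l + R * 1           ≡⟨ cong (_ +_) (*-identityʳ R) ⟩
    # (λ i → A (j + i * D)) l + R               ≤⟨ +-monoˡ-≤ R (∑-mono-< l (hit j eq)) ⟩
    ∑ (λ _ → # (λ i → U (j + i * D)) l) l + R   ≡⟨ cong (_+ R) (∑-const _ l) ⟩
    l * # (λ i → U (j + i * D)) l + R           ≡⟨ +-comm _ R ⟩
    R + l * # (λ i → U (j + i * D)) l           ∎
    where open ≤-Reasoning

  -- For each position i, the translate of U by i * D contributes at most `# U n`.
  exits : ∑ (λ j → # (λ i → U (j + i * D)) l) n ≤ l * g
  exits = begin
    ∑ (λ j → # (λ i → U (j + i * D)) l) n   ≡⟨ ∑-swap (λ j i → ⟦ U (j + i * D) ⟧) n l ⟩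
    ∑ (λ i → # (λ j → U (j + i * D)) n) l   ≤⟨ ∑-mono l (λ i → ≤-trans
                                                 (#-shift-≤ U n (i * D) (λ z Uz → bounded z (proj₁ (∧-true Uz)))) #U≤g) ⟩
    ∑ (λ _ → g) l                           ≡⟨ ∑-const g l ⟩
    l * g                                   ∎
    where open ≤-Reasoning

  -- As j varies, position i of the window sweeps [i * D, n + i * D) and so misses at most i * D
  -- points of A.
  hits : l * # A n ≤ ∑ (λ j → # (λ i → A (j + i * D)) l) n + l * (l * D)
  hits = begin
    l * # A n                                           ≡⟨ ∑-const (# A n) l ⟨
    ∑ (λ _ → # A n) l                                   ≤⟨ ∑-mono-< l (λ i i<l → ≤-trans (#-shift-≥ A n (i * D))
                                                             (+-monoʳ-≤ _ (*-monoˡ-≤ D (<⇒≤ i<l)))) ⟩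
    ∑ (λ i → # (λ j → A (j + i * D)) n + l * D) l       ≡⟨ ∑-+ (λ i → # (λ j → A (j + i * D)) n) _ l ⟩
    ∑ (λ i → # (λ j → A (j + i * D)) n) l + ∑ (λ _ → l * D) l
                                                        ≡⟨ cong₂ _+_ (∑-swap (λ j i → ⟦ A (j + i * D) ⟧) n l) (sym (∑-const (l * D) l)) ⟨
    ∑ (λ j → # (λ i → A (j + i * D)) l) n + l * (l * D) ∎
    where open ≤-Reasoning

  density-bound : l * # A n + R * # M n ≤ R * n + l * (l * g) + l * (l * D)
  density-bound = begin
    l * # A n + R * # M n                         ≤⟨ +-monoˡ-≤ _ hits ⟩
    h + l * (l * D) + R * # M n                   ≡⟨ swap-last h (l * (l * D)) (R * # M n) ⟩
    h + R * # M n + l * (l * D)                   ≡⟨ cong (λ v → h + v + l * (l * D)) (∑-* R (⟦_⟧ ∘ M) n) ⟨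
    h + ∑ (λ j → R * ⟦ M j ⟧) n + l * (l * D)     ≡⟨ cong (_+ l * (l * D)) (∑-+ _ (λ j → R * ⟦ M j ⟧) n) ⟨
    ∑ (λ j → # (λ i → A (j + i * D)) l + R * ⟦ M j ⟧) n + l * (l * D)
                                                  ≤⟨ +-monoˡ-≤ _ (∑-mono n window-bound) ⟩
    ∑ (λ j → R + l * # (λ i → U (j + i * D)) l) n + l * (l * D)
                                                  ≡⟨ cong (_+ l * (l * D)) (∑-+ (λ _ → R) _ n) ⟩
    ∑ (λ _ → R) n + ∑ (λ j → l * # (λ i → U (j + i * D)) l) n + l * (l * D)
                                                  ≡⟨ cong (_+ l * (l * D)) (cong₂ _+_ (trans (∑-const R n) (*-comm n R)) (∑-* l _ n)) ⟩
    R * n + l * ∑ (λ j → # (λ i → U (j + i * D)) l) n + l * (l * D)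
                                                  ≤⟨ +-monoˡ-≤ (l * (l * D)) (+-monoʳ-≤ (R * n) (*-monoʳ-≤ l exits)) ⟩
    R * n + l * (l * g) + l * (l * D)             ∎
    where
    open ≤-Reasoning
    h = ∑ (λ j → # (λ i → A (j + i * D)) l) n
    swap-last : ∀ a b c → a + b + c ≡ a + c + b
    swap-last = solve-∀

-- Arithmetic of the parameters.

-- Density at least 1/q at length n forces R / l ≥ 1/(2q), since 2ql ≤ n absorbs the error l².
density-lower-bound : ∀ q l R n a .{{_ : NonZero n}} → n ≤ q * a → l * a ≤ R * n + l * l →
  2 * q * l ≤ n → l ≤ 2 * q * R
density-lower-bound q l R n a n≤qa la≤ 2ql≤n = *-cancelʳ-≤ l (2 * q * R) n (cancel-≤ 0
  (+-mono-≤ (+-mono-≤ (*-monoʳ-≤ (2 * l) n≤qa) (*-monoʳ-≤ (2 * q) la≤)) (*-monoʳ-≤ l 2ql≤n))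
  (combination q l R n a))
  where
  combination : ∀ q l R n a →
    l * n + (2 * l * (q * a) + 2 * q * (R * n + l * l) + l * n) + 0
      ≡ 2 * q * R * n + (2 * l * n + 2 * q * (l * a) + l * (2 * q * l))
  combination = solve-∀

-- The whole falls short of density R / l by at most 1/(64q²), and the other three quarters hardly
-- exceed R / l. So this quarter keeps at least half of R / l, hence 1/(4q).
quarter-lower-bound : ∀ q l R w a c .{{_ : NonZero q}} .{{_ : NonZero l}} .{{_ : NonZero R}} →
  l * a ≤ l * c + (R * (3 * w) + 2 * (l * l)) →
  64 * (q * q) * R * (4 * w) ≤ l * (64 * (q * q) * a + 4 * w) →
  l ≤ 2 * q * R → 8 * (l * l) ≤ w → w ≤ 4 * q * c
quarter-lower-bound q l R w a c la≤ ERn≤ l≤2qR 8ll≤w = *-cancelˡ-≤ l (begin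
  l * w               ≤⟨ *-monoˡ-≤ w l≤2qR ⟩
  2 * q * R * w       ≡⟨ *-assoc (2 * q) R w ⟩
  2 * q * (R * w)     ≤⟨ *-monoʳ-≤ (2 * q) Rw≤2lc ⟩
  2 * q * (2 * l * c) ≡⟨ reorder q l c ⟩
  l * (4 * q * c)     ∎)
  where
  open ≤-Reasoning
  instance _ = m*n≢0 q q
  reorder : ∀ q l c → 2 * q * (2 * l * c) ≡ l * (4 * q * c)
  reorder = solve-∀
  combination : ∀ q p l R w a c →
    40 * p * (R * w) + (64 * p * (l * c + (R * (3 * w) + 2 * (l * l))) + l * (64 * p * a + 4 * w)
        + 4 * w * (2 * q * R) + 8 * (R * w) * p + 16 * p * (R * w)) + 16 * p * l * c
      ≡ 40 * p * (2 * l * c) + (64 * p * (l * a) + 64 * p * R * (4 * w)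
        + 4 * w * l + 8 * (R * w) * q + 16 * p * (8 * (l * l)))
  combination = solve-∀

  Rw≤2lc : R * w ≤ 2 * l * c
  -- The estimates yield 5/8 of R / l; the slack lowers this to one half.
  Rw≤2lc = *-cancelˡ-≤ (40 * (q * q)) {{m*n≢0 40 (q * q)}} (cancel-≤ (16 * (q * q) * l * c)
    (+-mono-≤ (+-mono-≤ (+-mono-≤ (+-mono-≤ (*-monoʳ-≤ (64 * (q * q)) la≤) ERn≤)
      (*-monoʳ-≤ (4 * w) l≤2qR)) (*-monoʳ-≤ (8 * (R * w)) (m≤m*n q q)))
      (*-monoʳ-≤ (16 * (q * q)) (≤-trans 8ll≤w (m≤n*m w R))))
    (combination q (q * q) l R w a c))

-- R * c is at least lw/(8q²), while l * a lies below 4Rw by at most lw/(16q²). What remains,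
-- lw/(16q²) = 8l²us by the choice of k, exceeds the error 4l²us + 2l²s.
parameters-too-large : ∀ q l k R u s a c (let w = k * u * s) → k ≡ 128 * l * (q * q) →
  .{{_ : NonZero q}} .{{_ : NonZero l}} .{{_ : NonZero u}} .{{_ : NonZero s}} →
  w ≤ 4 * q * c → l ≤ 2 * q * R →
  64 * (q * q) * R * (4 * w) ≤ l * (64 * (q * q) * a + 4 * w) →
  l * a + R * c ≤ R * (4 * w) + l * (l * (4 * u * s)) + l * (l * (2 * s)) → ⊥
parameters-too-large q l _ R u s a c refl w≤4qc l≤2qR ERn≤ density =
  ≤⇒≯ (cancel-≤ 0 (+-mono-≤ (+-mono-≤ (*-monoʳ-≤ (8 * l) w≤4qc) (*-monoʳ-≤ (32 * q * c) l≤2qR))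
         (+-mono-≤ ERn≤ (*-monoʳ-≤ (64 * (q * q)) density)))
       (combination q l R u s a c))
    (begin-strict
      128 * t                          <⟨ *-monoˡ-< t (toWitness {a? = 129 ≤? 256} _) ⟩
      256 * t                          ≤⟨ m≤m*n (256 * t) u ⟩
      256 * t * u                      ∎)
  where
  open ≤-Reasoning
  t = l * l * (q * q) * s
  instance
    _ = m*n≢0 l l
    _ = m*n≢0 q q
    _ = m*n≢0 (l * l) (q * q)
    _ = m*n≢0 (l * l * (q * q)) s
  combination : ∀ q l R u s a c →
    256 * (l * l * (q * q) * s) * u
      + (8 * l * (4 * q * c) + 32 * q * c * (2 * q * R)
        + (l * (64 * (q * q) * a + 4 * (128 * l * (q * q) * u * s))
          + 64 * (q * q) * (R * (4 * (128 * l * (q * q) * u * s)) + l * (l * (4 * u * s)) + l * (l * (2 * s))))) + 0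
      ≡ 128 * (l * l * (q * q) * s)
      + (8 * l * (128 * l * (q * q) * u * s) + 32 * q * c * l
        + (64 * (q * q) * R * (4 * (128 * l * (q * q) * u * s))
          + 64 * (q * q) * (l * a + R * c)))
  combination = solve-∀

-- The cube and its reflections in a progression-free set.

Cube-translate : ∀ {s A B} p k → (∀ x → A x ≡ B (p + x)) → Cube s A k → Cube s B k
Cube-translate p zero    A≡B (y , Ay)      = p + y , trans (sym (A≡B y)) Ay
Cube-translate {B = B} p (suc k) A≡B (d , d<s , c) = d , d<s , Cube-translate p k
  (λ x → cong₂ _∧_ (A≡B x) (trans (A≡B (suc d + x)) (cong B (exchange p (suc d) x)))) c
  where
  exchange : ∀ p d x → p + (d + x) ≡ d + (p + x)
  exchange = solve-∀

-- A cube found in the restricted set has all its vertices below w.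
restrict : ℕ → (ℕ → Bool) → ℕ → Bool
restrict w A x = A x ∧ (x <ᵇ w)

#-restrict : ∀ A w → # A w ≤ # (restrict w A) w
#-restrict A w = ∑-mono-< w λ x x<w → ⟦⟧-mono λ Ax → true-∧ Ax (true-<ᵇ x<w)

-- Working in a densest block of length s keeps the differences at most s, however long the window.
cube-in-window : ∀ q k v s A → cube-threshold k q ≤ s → 1 ≤ v →
  v * s ≤ q * # A (v * s) → Cube s (restrict (v * s) A) k
cube-in-window q k v s A t≤s 1≤v dense
  with pigeonhole (λ j → # (λ i → A (j * s + i)) s) v 1≤v
... | j , j<v , popular =
  Cube-translate (j * s) k (λ _ → refl)
    (cube-lemma k q t≤s (λ i → restrict (v * s) A (j * s + i)) (*-cancelˡ-≤ v {{>-nonZero 1≤v}} (begin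
      v * s                                              ≤⟨ dense ⟩
      q * # A (v * s)                                    ≡⟨ cong (q *_) (∑-blocks (⟦_⟧ ∘ A) s v) ⟩
      q * ∑ (λ j → # (λ i → A (j * s + i)) s) v          ≤⟨ *-monoʳ-≤ q popular ⟩
      q * (v * # (λ i → A (j * s + i)) s)                ≤⟨ *-monoʳ-≤ q (*-monoʳ-≤ v (∑-mono-< s λ i i<s →
                                                              ⟦⟧-mono λ Ai → true-∧ Ai (true-<ᵇ (inside i i<s)))) ⟩
      q * (v * # (λ i → restrict (v * s) A (j * s + i)) s) ≡⟨ exchange q v _ ⟩
      v * (q * # (λ i → restrict (v * s) A (j * s + i)) s) ∎)))
  where
  open ≤-Reasoning
  exchange : ∀ a b c → a * (b * c) ≡ b * (a * c)
  exchange = solve-∀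
  inside : ∀ i → i < s → j * s + i < v * s
  inside i i<s = begin-strict
    j * s + i   <⟨ +-monoʳ-< (j * s) i<s ⟩
    j * s + s   ≡⟨ +-comm (j * s) s ⟩
    suc j * s   ≤⟨ *-monoˡ-≤ s j<v ⟩
    v * s       ∎

module Configuration
  (q l k u s : ℕ) .{{_ : NonZero k}} .{{_ : NonZero u}}
  (threshold : cube-threshold k q ≤ s)
  (A : ℕ → Bool) (free : APFree A)
  (dense : k * u * s ≤ q * # (λ i → A (k * u * s + i)) (k * u * s))
  where

  -- These satisfy n = k * g, so k gains of more than g points overfill [0,n).
  w n g : ℕ
  w = k * u * s
  n = 4 * w
  g = 4 * u * s

  -- X is A ∩ [0,w) and B is A ∩ [w,2w); `w <ᵇ suc m` expresses w ≤ m.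
  X B : ℕ → Bool
  X = restrict w A
  B m = A m ∧ ((w <ᵇ suc m) ∧ (m <ᵇ 2 * w))

  B⇒ : ∀ m → B m ≡ true → A m ≡ true × w ≤ m × m < 2 * w
  B⇒ m Bm with ∧-true {A m} Bm
  ... | Am , m∈ with ∧-true {w <ᵇ suc m} m∈
  ...   | w≤m , m<2w = Am , ≤-pred (<ᵇ-true {w} w≤m) , <ᵇ-true {m} m<2w

  B-double : ∀ m → B m ≡ true → 2 * m < n
  B-double m Bm = subst (2 * m <_) (sym (*-assoc 2 2 w)) (*-monoʳ-< 2 (proj₂ (proj₂ (B⇒ m Bm))))

  cube : Cube s B k
  cube = Cube-translate w k (λ x → cong (A (w + x) ∧_) (window x))
    (cube-in-window q k (k * u) s (λ i → A (w + i)) threshold (>-nonZero⁻¹ (k * u) {{m*n≢0 k u}}) dense)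
    where
    window : ∀ x → (x <ᵇ w) ≡ ((w <ᵇ suc (w + x)) ∧ (w + x <ᵇ 2 * w))
    window x rewrite true-<ᵇ (s≤s (m≤m+n w x)) with x <ᵇ w in eq
    ... | true  = sym (true-<ᵇ (+-monoʳ-< w (≤-trans (<ᵇ-true {x} eq) (m≤m+n w 0))))
    ... | false with w + x <ᵇ 2 * w in eq′
    ...   | false = refl
    ...   | true  = trans (sym eq) (true-<ᵇ
              (subst (x <_) (+-identityʳ w) (+-cancelˡ-< w x (w + 0) (<ᵇ-true {w + x} eq′))))

  open Reflections X n

  ⊑B-bounded : ∀ {M} → M ⊑ B → ∀ z → M z ≡ true → z < n
  ⊑B-bounded M⊑ z Mz with M⊑ z Mz
  ... | m , x , Bm , Xx , eq = begin-strict
    z      ≤⟨ m≤n+m z x ⟩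
    x + z  ≡⟨ eq ⟩
    2 * m  <⟨ B-double m Bm ⟩
    n      ∎
    where open ≤-Reasoning

  -- If z were in A, the progression x, m, z would lie in A and be trivial, against x < w ≤ m.
  ⊑B-disjoint : ∀ {M} → M ⊑ B → ∀ z → M z ≡ true → A z ≡ false
  ⊑B-disjoint M⊑ z Mz with A z in Az | M⊑ z Mz
  ... | false | _ = refl
  ... | true  | m , x , Bm , Xx , eq with B⇒ m Bm | ∧-true {A x} Xx
  ...   | Am , w≤m , _ | Ax , x<w with free x z m Ax Az Am eq
  ...     | refl = contradiction (<ᵇ-true {x} x<w)
              (≤⇒≯ (subst (w ≤_) (*-cancelˡ-≡ m x 2 (trans (sym eq) (cong (x +_) (sym (+-identityʳ x))))) w≤m))

  density : l * # A n + r₃ l * # A w ≤ r₃ l * n + l * (l * g) + l * (l * (2 * s))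
  density with slow-step-or-large {# A w} g B k cube
                 (λ y By → ≤-trans (#-restrict A w) (#-reflection (proj₁ (proj₂ (B⇒ y By))) (B-double y By)))
  ... | inj₁ (d , M , d<s , M⊑ , M′⊑ , large , slow) = begin
    l * # A n + r₃ l * # A w                           ≤⟨ +-monoʳ-≤ (l * # A n) (*-monoʳ-≤ (r₃ l) large) ⟩
    l * # A n + r₃ l * # M n                           ≤⟨ density-bound ⟩
    r₃ l * n + l * (l * g) + l * (l * (2 * suc d))     ≤⟨ +-monoʳ-≤ (r₃ l * n + l * (l * g))
                                                            (*-monoʳ-≤ l (*-monoʳ-≤ l (*-monoʳ-≤ 2 d<s))) ⟩
    r₃ l * n + l * (l * g) + l * (l * (2 * s))         ∎
    where
    open ≤-Reasoning
    open SlidingProgressions A M (M ∪ M + (2 * suc d)) n (2 * suc d) l (r₃ l) g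
      -- `d + 1 * suc d` is the predecessor of the common difference `2 * suc d`.
      (λ j → #≤r₃ (APFree-dilate (d + 1 * suc d) (APFree-translate j free)) l)
      (⊑B-disjoint M⊑) (∪+-⊇ M (2 * suc d)) (∪+-shift M (2 * suc d)) (⊑B-bounded M′⊑) slow
  ... | inj₂ (M , _ , _ , large) = contradiction (begin-strict
    k * g        <⟨ *-monoʳ-< k ≤-refl ⟩
    k * suc g    ≤⟨ large ⟩
    # M n        ≤⟨ #≤ M n ⟩
    n            ≡⟨ n≡kg k u s ⟩
    k * g        ∎) (<-irrefl refl)
    where
    open ≤-Reasoning
    n≡kg : ∀ k u s → 4 * (k * u * s) ≡ k * (4 * u * s)
    n≡kg = solve-∀

-- The density decrement.

-- Of [0,w), [w,2w) and [2w,4w), all but one are bounded by `r₃-scaling`, at a cost of l² each.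
quarter-split : ∀ {A} l .{{_ : NonZero l}} w → APFree A →
  l * # A (4 * w) ≤ l * # A w + (r₃ l * (3 * w) + 2 * (l * l)) ×
  l * # A (4 * w) ≤ l * # (λ i → A (w + i)) w + (r₃ l * (3 * w) + 2 * (l * l))
quarter-split {A} l w free =
    cancel-≤ 0 (+-mono-≤ split (+-mono-≤ (scaled second w) (scaled rest (2 * w)))) (first-quarter l (r₃ l) w _ _ _ _)
  , cancel-≤ 0 (+-mono-≤ split (+-mono-≤ (scaled free w) (scaled rest (2 * w)))) (second-quarter l (r₃ l) w _ _ _ _)
  where
  second : APFree (λ i → A (w + i))
  second = APFree-translate w free
  rest : APFree (λ i → A (w + (w + i)))
  rest = APFree-translate w second
  scaled : ∀ {C} → APFree C → ∀ m → l * # C m ≤ r₃ l * m + l * l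
  scaled C-free m = ≤-trans (*-monoʳ-≤ l (#≤r₃ C-free m)) (r₃-scaling l m)
  split : l * # A (4 * w) ≤ l * (# A w + (# (λ i → A (w + i)) w + # (λ i → A (w + (w + i))) (2 * w)))
  split = *-monoʳ-≤ l (≤-reflexive (begin
    # A (4 * w)                                    ≡⟨ ∑-split (⟦_⟧ ∘ A) w (3 * w) ⟩
    # A w + # (λ i → A (w + i)) (w + 2 * w)        ≡⟨ cong (# A w +_) (∑-split (λ i → ⟦ A (w + i) ⟧) w (2 * w)) ⟩
    # A w + (# (λ i → A (w + i)) w + # (λ i → A (w + (w + i))) (2 * w)) ∎))
    where open ≡-Reasoning
  first-quarter : ∀ l R w a a₁ a₂ a₃ →
    l * a + (l * (a₁ + (a₂ + a₃)) + (R * w + l * l + (R * (2 * w) + l * l))) + 0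
      ≡ l * a₁ + (R * (3 * w) + 2 * (l * l)) + (l * a + (l * a₂ + l * a₃))
  first-quarter = solve-∀
  second-quarter : ∀ l R w a a₁ a₂ a₃ →
    l * a + (l * (a₁ + (a₂ + a₃)) + (R * w + l * l + (R * (2 * w) + l * l))) + 0
      ≡ l * a₂ + (R * (3 * w) + 2 * (l * l)) + (l * a + (l * a₁ + l * a₃))
  second-quarter = solve-∀

-- The second alternative says r₃ n / n ≤ r₃ l / l - 1/(64q²). If both fail, the first two quarters
-- of an extremal set are dense and `Configuration` yields the inequality refuted by
-- `parameters-too-large`. Here k is the cube dimension, s the block length, and u makes w at least
-- 8l².
density-decrement-at : ∀ q l k u s →
  .{{_ : NonZero q}} .{{_ : NonZero l}} .{{_ : NonZero k}} .{{_ : NonZero u}} .{{_ : NonZero s}} →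
  k ≡ 128 * l * (q * q) → 8 * (l * l) ≤ u → cube-threshold k (4 * q) ≤ s →
  ∃[ n ] 1 ≤ n × (q * r₃ n ≤ n ⊎ l * (64 * (q * q) * r₃ n + n) ≤ 64 * (q * q) * r₃ l * n)
density-decrement-at q l k u s k≡ 8ll≤u threshold = n , >-nonZero⁻¹ n , decide
  where
  open ≤-Reasoning
  w = k * u * s
  n = 4 * w
  R = r₃ l
  instance
    _ = m*n≢0 k u
    _ = m*n≢0 (k * u) s
    _ = m*n≢0 4 w
    _ = m*n≢0 q q

  8ll≤w : 8 * (l * l) ≤ w
  8ll≤w = ≤-trans 8ll≤u (≤-trans (m≤n*m u k) (m≤m*n (k * u) s))

  2ql≤n : 2 * q * l ≤ n
  2ql≤n = begin
    2 * q * l              ≤⟨ *-monoˡ-≤ l (*-monoʳ-≤ 2 (m≤m*n q q)) ⟩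
    2 * (q * q) * l        ≤⟨ m≤n*m _ 64 ⟩
    64 * (2 * (q * q) * l) ≡⟨ trans (reorder l (q * q)) (sym k≡) ⟩
    k                      ≤⟨ ≤-trans (m≤m*n k u) (m≤m*n (k * u) s) ⟩
    w                      ≤⟨ m≤n*m w 4 ⟩
    n                      ∎
    where
    reorder : ∀ l p → 64 * (2 * p * l) ≡ 128 * l * p
    reorder = solve-∀

  decide : q * r₃ n ≤ n ⊎ l * (64 * (q * q) * r₃ n + n) ≤ 64 * (q * q) * R * n
  decide with q * r₃ n ≤? n | l * (64 * (q * q) * r₃ n + n) ≤? 64 * (q * q) * R * n
  ... | yes sparse | _       = inj₁ sparse
  ... | no _       | yes dec = inj₂ dec
  ... | no dense   | no ¬dec with extremal n
  ...   | A , free , #A≡ = contradiction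
            (parameters-too-large q l k R u s (# A n) (# A w) k≡ w≤4qa₁ l≤2qR ER≤ density)
            λ ()
    where
    ER≤ : 64 * (q * q) * R * n ≤ l * (64 * (q * q) * # A n + n)
    ER≤ = subst (λ a → 64 * (q * q) * R * n ≤ l * (64 * (q * q) * a + n)) (sym #A≡) (<⇒≤ (≰⇒> ¬dec))

    l≤2qR : l ≤ 2 * q * R
    l≤2qR = density-lower-bound q l R n (r₃ n) (<⇒≤ (≰⇒> dense)) (r₃-scaling l n) 2ql≤n

    instance
      R≢0 : NonZero R
      R≢0 = ≢-nonZero λ R≡0 → contradiction
        (subst (l ≤_) (trans (cong (2 * q *_) R≡0) (*-zeroʳ (2 * q))) l≤2qR) (<⇒≱ (>-nonZero⁻¹ l))

    w≤4qa₁ : w ≤ 4 * q * # A w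
    w≤4qa₁ = quarter-lower-bound q l R w (# A n) (# A w)
      (proj₁ (quarter-split l w free)) ER≤ l≤2qR 8ll≤w

    -- The second quarter has density at least 1/(4q), hence the inverse density `4 * q` here and in
    -- the cube threshold.
    open Configuration (4 * q) l k u s threshold A free
      (quarter-lower-bound q l R w (# A n) _ (proj₂ (quarter-split l w free)) ER≤ l≤2qR 8ll≤w)
      using (density)

density-decrement : ∀ q l .{{_ : NonZero q}} .{{_ : NonZero l}} → ∃[ n ] 1 ≤ n ×
  (q * r₃ n ≤ n ⊎ l * (64 * (q * q) * r₃ n + n) ≤ 64 * (q * q) * r₃ l * n)
density-decrement q l = density-decrement-at q l k (8 * (l * l)) (cube-threshold k (4 * q)) refl ≤-refl ≤-refl
  where
  k = 128 * l * (q * q)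
  instance
    _ = m*n≢0 128 l
    _ = m*n≢0 q q
    _ = m*n≢0 (128 * l) (q * q)
    _ = m*n≢0 l l
    _ = m*n≢0 8 (l * l)
    _ = >-nonZero (1≤cube-threshold k (4 * q))

-- Iterating the decrement and passing to all large N.

module Iteration (q E : ℕ)
  (decrement : ∀ l → 1 ≤ l → ∃[ n ] 1 ≤ n × (q * r₃ n ≤ n ⊎ l * (E * r₃ n + n) ≤ E * r₃ l * n))
  where

  decrease : ∀ {a R} l n j .{{_ : NonZero l}} →
    l * (E * a + n) ≤ E * R * n → E * R + j * l ≤ E * l → E * a + suc j * n ≤ E * n
  decrease {a} {R} l n j step bound =
    *-cancelˡ-≤ l (cancel-≤ 0 (+-mono-≤ step (*-monoʳ-≤ n bound)) (combination E R a l n j))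
    where
    combination : ∀ E R a l n j →
      l * (E * a + suc j * n) + (E * R * n + n * (E * l)) + 0
        ≡ l * (E * n) + (l * (E * a + n) + n * (E * R + j * l))
    combination = solve-∀

  -- The density at length 1 is at most 1, and each round lowers the bound by 1/E, an amount
  -- independent of the current length.
  iterated : ∀ j → ∃[ n ] 1 ≤ n × (q * r₃ n ≤ n ⊎ E * r₃ n + j * n ≤ E * n)
  iterated zero = 1 , ≤-refl ,
    inj₂ (subst (_≤ E * 1) (sym (+-identityʳ (E * r₃ 1))) (*-monoʳ-≤ E (r₃≤ 1)))
  iterated (suc j) with iterated j
  ... | l , 1≤l , inj₁ sparse = l , 1≤l , inj₁ sparse
  ... | l , 1≤l , inj₂ bound with decrement l 1≤l
  ...   | n , 1≤n , inj₁ sparse = n , 1≤n , inj₁ sparse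
  ...   | n , 1≤n , inj₂ step   = n , 1≤n , inj₂ (decrease l n j {{>-nonZero 1≤l}} step bound)

  sparse-interval : ∃[ n ] 1 ≤ n × q * r₃ n ≤ n
  -- After E + 1 decrements the density would be negative.
  sparse-interval with iterated (suc E)
  ... | n , 1≤n , inj₁ sparse = n , 1≤n , sparse
  ... | n , 1≤n , inj₂ bound  = contradiction (m+n≤o⇒n≤o (E * r₃ n) bound)
          (<⇒≱ (*-monoˡ-< n {{>-nonZero 1≤n}} (n<1+n E)))

-- By `r₃-scaling`, r₃ N / N ≤ r₃ n / n + n / N, and both terms are at most 1/(4q). The sum 1/(2q)
-- leaves room for the strict inequality.
interval-to-tail : ∀ q n .{{_ : NonZero n}} → 4 * q * r₃ n ≤ n →
  ∀ N → 1 ≤ N → 4 * q * n ≤ N → q * r₃ N < N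
interval-to-tail q n sparse N 1≤N N₀≤N = halve N 1≤N
  (*-cancelˡ-≤ n (cancel-≤ 0
    (+-mono-≤ (+-mono-≤ (*-monoʳ-≤ (4 * q) (r₃-scaling n N)) (*-monoʳ-≤ N sparse))
      (*-monoʳ-≤ n N₀≤N))
    (combination q n N (r₃ n) (r₃ N))))
  where
  combination : ∀ q n N r a →
    n * (4 * (q * a)) + (4 * q * (r * N + n * n) + N * n + n * N) + 0
      ≡ n * (2 * N) + (4 * q * (n * a) + N * (4 * q * r) + n * (4 * q * n))
  combination = solve-∀
  halve : ∀ N {x} → 1 ≤ N → 4 * x ≤ 2 * N → x < N
  halve N {x} 1≤N 4x≤2N with x <? N
  ... | yes x<N = x<N
  ... | no x≮N = contradiction (≤-trans (*-monoʳ-≤ 4 (≮⇒≥ x≮N)) 4x≤2N)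
                   (<⇒≱ (*-monoˡ-< N {{>-nonZero 1≤N}} (toWitness {a? = 3 ≤? 4} _)))

eventually-sparse : ∀ q .{{_ : NonZero q}} → ∃[ N₀ ] (∀ N → 1 ≤ N → N₀ ≤ N → q * r₃ N < N)
eventually-sparse q = from-interval (Iteration.sparse-interval (4 * q) (64 * (4 * q * (4 * q)))
  λ l 1≤l → density-decrement (4 * q) l {{m*n≢0 4 q}} {{>-nonZero 1≤l}})
  where
  from-interval : ∃[ n ] 1 ≤ n × 4 * q * r₃ n ≤ n →
                  ∃[ N₀ ] (∀ N → 1 ≤ N → N₀ ≤ N → q * r₃ N < N)
  from-interval (n , 1≤n , sparse) = 4 * q * n , interval-to-tail q n {{>-nonZero 1≤n}} sparse

-- Opened only here because the prefix + of ℤ makes sections of _+_ ambiguous.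
open import Data.Integer.Base as ℤ using (+_)
import Data.Integer.Properties as ℤ
open import Data.Nat.Coprimality using (Coprime)
open import Data.Rational.Base as ℚ using (0ℚ; _/_; mkℚ; *<*)
import Data.Rational.Properties as ℚ
import Data.Rational.Unnormalised.Base as ℚᵘ
import Data.Rational.Unnormalised.Properties as ℚᵘ

-- The limit in the rationals.

-- A positive rational with denominator d + 1 is at least 1/(d + 1), so ε enters only through its
-- denominator.
/-<-mkℚ : ∀ a N .{{_ : NonZero N}} p d .(c : Coprime (suc p) (suc d)) → suc d * a < N →
          + a / N ℚ.< mkℚ (+ suc p) d c
/-<-mkℚ a N@(suc _) p d c lt = ℚ.toℚᵘ-cancel-< (ℚᵘ.<-respˡ-≃
  (ℚᵘ.≃-sym (ℚ.toℚᵘ-fromℚᵘ (+ a ℚᵘ./ N)))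
  (ℚᵘ.*<* (subst₂ ℤ._<_ (ℤ.pos-* a (suc d)) (ℤ.pos-* (suc p) N) (ℤ.+<+ (begin-strict
    a * suc d   ≡⟨ *-comm a (suc d) ⟩
    suc d * a   <⟨ lt ⟩
    N           ≤⟨ m≤n*m N (suc p) ⟩
    suc p * N   ∎)))))
  where open ≤-Reasoning

∣/-0∣ : ∀ a N .{{_ : NonZero N}} → ℚ.∣ + a / N ℚ.- 0ℚ ∣ ≡ + a / N
∣/-0∣ a N = trans (cong ℚ.∣_∣ (ℚ.+-identityʳ (+ a / N)))
  (ℚ.0≤p⇒∣p∣≡p (ℚ.nonNegative⁻¹ (+ a / N) {{ℚ.normalize-nonNeg a N}}))

theorem1p1 : HasLimit (λ N → + r₃ N / N) 0ℚ
theorem1p1 (mkℚ (+ zero)     d c) (*<* (ℤ.+<+ ()))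
theorem1p1 (mkℚ (ℤ.-[1+ _ ]) d c) (*<* ())
theorem1p1 (mkℚ (+ suc p)    d c) _ = limit (eventually-sparse (suc d))
  where
  limit : ∃[ N₀ ] (∀ N → 1 ≤ N → N₀ ≤ N → suc d * r₃ N < N) →
          ∃[ N₀ ] (∀ N .{{_ : NonZero N}} → N₀ ≤ N → ℚ.∣ + r₃ N / N ℚ.- 0ℚ ∣ ℚ.< mkℚ (+ suc p) d c)
  limit (N₀ , sparse) = N₀ , λ N N₀≤N →
    subst (ℚ._< mkℚ (+ suc p) d c) (sym (∣/-0∣ (r₃ N) N))
      (/-<-mkℚ (r₃ N) N p d c (sparse N (>-nonZero⁻¹ N) N₀≤N))
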